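{- For a finite bipartite graph $G$ the following are equivalent: (i) $G$ is an interval containment bigraph; (ii) $G$ is a chordal bigraph and a cocomparability bigraph; (iii) $G$ has no induced cycle of length $6$ and is a cocomparability bigraph.
   Context: Let $(X,Y)$ be a bipartition of $G$. $G$ is an interval containment bigraph if there are intervals $I_v$ ($v\in X\cup Y$) of the real line such that for $x\in X$, $y\in Y$, $xy\in E(G)$ iff $I_x\supseteq I_y$. $G$ is a chordal bigraph if it has no induced cycle of length greater than $4$. $G$ is a cocomparability bigraph if there exist linear orderings $\prec_X$ of $X$ and $\prec_Y$ of $Y$ such that for all $u,v\in X$, $w,z\in Y$ with $u\prec_X v$, $w\prec_Y z$ and $uz,vw\in E(G)$, at least one of $uw,vz$ is in $E(G)$. (Each of these notions does not depend on the chosen bipartition.)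
   Formalization: The intervals in (i) are closed, nonempty intervals with rational endpoints instead of intervals of the real line; since the graph is finite and only the order of the endpoints matters, the two notions agree. -}

module Defs where

open import Data.Nat using (ℕ; suc; _+_; _<_)
open import Data.Fin using (Fin; toℕ)
open import Data.Bool using (Bool; true)
open import Data.Sum using (_⊎_; inj₁; inj₂)
open import Data.Product using (Σ; _×_; ∃-syntax)
open import Data.Empty using (⊥)
open import Data.Rational using (ℚ; _≤_)
open import Relation.Nullary using (¬_)
open import Relation.Binary.PropositionalEquality using (_≡_)
open import Relation.Binary.Structures using (IsStrictTotalOrder)
open import Function.Definitions using (Injective)
open import Function.Bundles using (_⇔_)

-- A finite bipartite graph with a fixed bipartition (X , Y) = (Fin m , Fin n),
-- given by its (decidable) biadjacency relation.
BiGraph : ℕ → ℕ → Set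
BiGraph m n = Fin m → Fin n → Bool

module _ {m n : ℕ} (G : BiGraph m n) where

  Edge : Fin m → Fin n → Set
  Edge x y = G x y ≡ true

  Vertex : Set
  Vertex = Fin m ⊎ Fin n

  Adj : Vertex → Vertex → Set
  Adj (inj₁ x) (inj₁ x′) = ⊥
  Adj (inj₁ x) (inj₂ y)  = Edge x y
  Adj (inj₂ y) (inj₁ x)  = Edge x y
  Adj (inj₂ y) (inj₂ y′) = ⊥

  CycAdj : (k : ℕ) → Fin k → Fin k → Set
  CycAdj k i j =
    (suc (toℕ i) ≡ toℕ j) ⊎ (suc (toℕ j) ≡ toℕ i)
    ⊎ ((suc (toℕ i) ≡ k × toℕ j ≡ 0) ⊎ (suc (toℕ j) ≡ k × toℕ i ≡ 0))

  HasInducedCycle : ℕ → Set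
  HasInducedCycle k =
    Σ (Fin k → Vertex) λ c →
      Injective _≡_ _≡_ c × (∀ i j → (Adj (c i) (c j) ⇔ CycAdj k i j))

  IsChordalBigraph : Set
  IsChordalBigraph = ∀ k → 4 < k → ¬ HasInducedCycle k

  record Interval : Set where
    constructor [_,_]⟨_⟩
    field
      lo : ℚ
      hi : ℚ
      lo≤hi : lo ≤ hi

  _⊇ᴵ_ : Interval → Interval → Set
  I ⊇ᴵ J = Interval.lo I ≤ Interval.lo J × Interval.hi J ≤ Interval.hi I

  IsIntervalContainmentBigraph : Set
  IsIntervalContainmentBigraph =
    Σ (Fin m → Interval) λ IX → Σ (Fin n → Interval) λ IY →
      ∀ x y → (Edge x y ⇔ (IX x ⊇ᴵ IY y))

  IsCocomparabilityBigraph : Set₁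
  IsCocomparabilityBigraph =
    Σ (Fin m → Fin m → Set) λ _≺X_ → Σ (Fin n → Fin n → Set) λ _≺Y_ →
      IsStrictTotalOrder _≡_ _≺X_ × IsStrictTotalOrder _≡_ _≺Y_ ×
      (∀ u v w z → u ≺X v → w ≺Y z → Edge u z → Edge v w →
        Edge u w ⊎ Edge v z)

{-# OPTIONS --safe #-}

-- A containment representation orders X by left endpoints and Y by right
-- endpoints so that crossing edges uz, vw (u before v, w before z) force the
-- edge uw.  In an induced cycle, the x-vertex with the greatest left endpoint
-- then gives a chord unless the cycle has length 4.  Ordering both sides by left
-- endpoints gives a cocomparability ordering.
--
-- Conversely, fix a cocomparability ordering.  Two non-edges uw, vz are in
-- conflict if uz, vw are edges; then one of them lies to the upper right of the
-- other.  A non-edge that is upper right in one conflict and lower left in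
-- another spans an induced 6-cycle.  So, without induced 6-cycles, every
-- non-edge is never lower left or never upper right.  The non-edges that are
-- never lower left can all be realised by a violation at the left endpoints,
-- those that are never upper right by a violation at the right endpoints.
module Submission where

open import Defs
open import Data.Bool using (true; false; not)
import Data.Bool.Properties as Bool
open import Data.Empty using (⊥; ⊥-elim)
open import Data.Fin as Fin using (Fin; zero; suc; toℕ; fromℕ<)
import Data.Fin.Properties as Fin
open import Data.Fin.Patterns using (0F; 1F; 2F; 3F; 4F; 5F)
open import Data.Fin.Subset using (Subset; _∈_; ∣_∣)
open import Data.Fin.Subset.Properties using (p⊂q⇒∣p∣<∣q∣; ∣p∣≤n)
open import Data.Integer as ℤ using (+_)
import Data.Integer.Properties as ℤ
open import Data.List using (allFin; filter; map)
import Data.List.Extrema as Extrema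
open import Data.List.Extrema.Nat using (max; xs≤max; max<v⁺)
open import Data.List.Membership.Propositional.Properties
  using (∈-map⁺; ∈-filter⁺; ∈-filter⁻; ∈-allFin)
open import Data.List.Relation.Unary.All as All using (All)
import Data.List.Relation.Unary.All.Properties as All
open import Data.Nat as ℕ using (ℕ; zero; suc; _+_; _*_; _∸_; s≤s; z≤n)
open import Data.Nat.Coprimality using (1-coprimeTo) renaming (sym to coprime-sym)
open import Data.Nat.Divisibility using (_∣_; divides; >⇒∤)
import Data.Nat.Properties as ℕ
open import Data.Product using (∃; ∃₂; _×_; _,_; proj₁; proj₂; uncurry; <_,_>)
open import Data.Rational as ℚ using (ℚ; mkℚ; *≤*)
import Data.Rational.Properties as ℚ
open import Data.Sum as Sum using (_⊎_; inj₁; inj₂)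
import Data.Sum.Properties as Sum
open import Data.Vec using (tabulate)
open import Data.Vec.Properties using (lookup∘tabulate; lookup⇒[]=; []=⇒lookup)
open import Function using (_∘_; id)
open import Function.Bundles using (_⇔_; mk⇔; Equivalence)
open import Function.Definitions using (Injective)
open import Level using (Level; 0ℓ)
open import Relation.Binary
  using (DecTotalOrder; Rel; Decidable; Irreflexive; Transitive; Tri; tri<; tri≈; tri>)
import Relation.Binary.Construct.Flip.EqAndOrd as Flip
open import Relation.Binary.PropositionalEquality
  using (_≡_; refl; sym; trans; cong; subst; subst₂; isEquivalence; module ≡-Reasoning)
open import Relation.Binary.Structures using (IsStrictTotalOrder)
open import Relation.Binary.Structures.Biased using (isStrictTotalOrderᶜ)
open import Relation.Nullary using (¬_; Dec; yes; no; does; contradiction)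
open import Relation.Nullary.Decidable
  using (_×-dec_; _⊎-dec_; _→-dec_; ¬?; map′; from-yes; dec-true)

private
  variable
    ℓ : Level
    k m n : ℕ

infix 2 _⇔-dec_
_⇔-dec_ : {A B : Set} → Dec A → Dec B → Dec (A ⇔ B)
A? ⇔-dec B? = map′ (uncurry mk⇔) < Equivalence.to , Equivalence.from >
                   ((A? →-dec B?) ×-dec (B? →-dec A?))

Edge? : (G : BiGraph m n) → Decidable (Edge G)
Edge? G x y = G x y Bool.≟ true

-- Chordality

-- One orientation of the cycle, so that steps can be counted modulo `k`.
Next : ∀ k → Fin k → Fin k → Set
Next k i j = suc (toℕ i) ≡ toℕ j ⊎ (suc (toℕ i) ≡ k × toℕ j ≡ 0)

Next⇒CycAdj : (G : BiGraph m n) {i j : Fin k} → Next k i j → CycAdj G k i j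
Next⇒CycAdj G (inj₁ p) = inj₁ p
Next⇒CycAdj G (inj₂ p) = inj₂ (inj₂ (inj₁ p))

CycAdj-sym : (G : BiGraph m n) {i j : Fin k} → CycAdj G k i j → CycAdj G k j i
CycAdj-sym G (inj₁ p)               = inj₂ (inj₁ p)
CycAdj-sym G (inj₂ (inj₁ p))        = inj₁ p
CycAdj-sym G (inj₂ (inj₂ (inj₁ p))) = inj₂ (inj₂ (inj₂ p))
CycAdj-sym G (inj₂ (inj₂ (inj₂ p))) = inj₂ (inj₂ (inj₁ p))

CycAdj⇒Next : (G : BiGraph m n) {i j : Fin k} → CycAdj G k i j → Next k i j ⊎ Next k j i
CycAdj⇒Next G (inj₁ p)               = inj₁ (inj₁ p)
CycAdj⇒Next G (inj₂ (inj₁ p))        = inj₂ (inj₁ p)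
CycAdj⇒Next G (inj₂ (inj₂ (inj₁ p))) = inj₁ (inj₂ p)
CycAdj⇒Next G (inj₂ (inj₂ (inj₂ p))) = inj₂ (inj₂ p)

next : (i : Fin k) → ∃ (Next k i)
next {k = suc k} i with suc (toℕ i) ℕ.<? suc k
... | yes i+1<k = fromℕ< i+1<k , inj₁ (sym (Fin.toℕ-fromℕ< i+1<k))
... | no  i+1≮k = zero , inj₂ (ℕ.≤-antisym (Fin.toℕ<n i) (ℕ.≮⇒≥ i+1≮k) , refl)

prev : (i : Fin k) → ∃ λ j → Next k j i
prev {k = suc k} zero    = Fin.fromℕ k , inj₂ (cong suc (Fin.toℕ-fromℕ k) , refl)
prev {k = suc k} (suc i) = Fin.inject₁ i , inj₁ (cong suc (Fin.toℕ-inject₁ i))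

Next-functional : {i j j′ : Fin k} → Next k i j → Next k i j′ → j ≡ j′
Next-functional (inj₁ p) (inj₁ q) = Fin.toℕ-injective (trans (sym p) q)
Next-functional {j = j} (inj₁ p) (inj₂ (q , _)) =
  contradiction (trans (sym p) q) (ℕ.<⇒≢ (Fin.toℕ<n j))
Next-functional {j′ = j′} (inj₂ (p , _)) (inj₁ q) =
  contradiction (trans (sym q) p) (ℕ.<⇒≢ (Fin.toℕ<n j′))
Next-functional (inj₂ (_ , p)) (inj₂ (_ , q)) = Fin.toℕ-injective (trans p (sym q))

-- The congruence `j` = `i` + `t` modulo `k`, with the number of laps as witness: walks compose by
-- addition, and a closed one yields a divisibility.
record Walk (k t : ℕ) (i j : Fin k) : Set where
  constructor _,_
  field
    laps   : ℕ
    length : toℕ j + laps * k ≡ t + toℕ i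

Next⇒Walk : {i j : Fin k} → Next k i j → Walk k 1 i j
Next⇒Walk (inj₁ p) = 0 , trans (ℕ.+-identityʳ _) (sym p)
Next⇒Walk {k} (inj₂ (p , q)) =
  1 , trans (cong (ℕ._+ 1 * k) q) (trans (ℕ.*-identityˡ k) (sym p))

Walk-trans : ∀ {t t′} {h i j : Fin k} → Walk k t h i → Walk k t′ i j → Walk k (t′ + t) h j
Walk-trans {k} {t} {t′} {h} {i} {j} (s , p) (s′ , q) = s′ + s , (begin
  toℕ j + (s′ + s) * k        ≡⟨ cong (toℕ j ℕ.+_) (ℕ.*-distribʳ-+ k s′ s) ⟩
  toℕ j + (s′ * k + s * k)    ≡⟨ ℕ.+-assoc (toℕ j) (s′ * k) (s * k) ⟨
  (toℕ j + s′ * k) + s * k    ≡⟨ cong (ℕ._+ s * k) q ⟩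
  (t′ + toℕ i) + s * k        ≡⟨ ℕ.+-assoc t′ (toℕ i) (s * k) ⟩
  t′ + (toℕ i + s * k)        ≡⟨ cong (t′ ℕ.+_) p ⟩
  t′ + (t + toℕ h)            ≡⟨ ℕ.+-assoc t′ t (toℕ h) ⟨
  (t′ + t) + toℕ h            ∎)
  where open ≡-Reasoning

closedWalk⇒∣ : ∀ {t} {i : Fin k} → Walk k t i i → k ∣ t
closedWalk⇒∣ {k} {t} {i} (s , p) =
  divides s (ℕ.+-cancelʳ-≡ (toℕ i) t (s * k) (trans (sym p) (ℕ.+-comm (toℕ i) (s * k))))

-- If `l` succeeded `h`, it would be `i`, closing a walk of length 2; if `h` succeeded `l`, a walk
-- of length 4 would close. No `k` above 4 divides either length.
distance3-nonadjacent : (G : BiGraph m n) {h i j l : Fin k} → 4 ℕ.< k →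
  Next k h i → Next k i j → Next k j l → ¬ CycAdj G k h l
distance3-nonadjacent G 4<k hi ij jl adj with CycAdj⇒Next G adj
... | inj₁ hl with refl ← Next-functional hi hl =
  >⇒∤ (ℕ.<-trans (s≤s (s≤s (s≤s z≤n))) 4<k)
      (closedWalk⇒∣ (Walk-trans (Next⇒Walk ij) (Next⇒Walk jl)))
... | inj₂ lh =
  >⇒∤ 4<k (closedWalk⇒∣ (Walk-trans (Walk-trans (Next⇒Walk hi) (Next⇒Walk ij))
                                   (Walk-trans (Next⇒Walk jl) (Next⇒Walk lh))))

Adj-inj₁ : (G : BiGraph m n) {x : Fin m} {p : Vertex G} → Adj G (inj₁ x) p →
  ∃ λ y → p ≡ inj₂ y × Edge G x y
Adj-inj₁ G {p = inj₂ y} e = y , refl , e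

Adj-inj₂ : (G : BiGraph m n) {y : Fin n} {p : Vertex G} → Adj G (inj₂ y) p →
  ∃ λ x → p ≡ inj₁ x × Edge G x y
Adj-inj₂ G {p = inj₁ x} e = x , refl , e

module _ {G : BiGraph m n} (representation : IsIntervalContainmentBigraph G) where

  private
    IX = proj₁ representation
    IY = proj₁ (proj₂ representation)
    rep = proj₂ (proj₂ representation)

    loX : Fin m → ℚ
    loX = Interval.lo ∘ IX

    loY : Fin n → ℚ
    loY = Interval.lo ∘ IY

    hiX : Fin m → ℚ
    hiX = Interval.hi ∘ IX

    hiY : Fin n → ℚ
    hiY = Interval.hi ∘ IY

    contains : ∀ {x y} → Edge G x y → (loX x ℚ.≤ loY y) × (hiY y ℚ.≤ hiX x)
    contains = Equivalence.to (rep _ _)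

    isEdge : ∀ {x y} → loX x ℚ.≤ loY y → hiY y ℚ.≤ hiX x → Edge G x y
    isEdge p q = Equivalence.from (rep _ _) (p , q)

  -- The left endpoints are compared through `v`, the right ones through `z`.
  crossing⇒edge : ∀ {u v w z} → loX u ℚ.≤ loX v → hiY w ℚ.≤ hiY z →
    Edge G u z → Edge G v w → Edge G u w
  crossing⇒edge u≤v w≤z uz vw =
    isEdge (ℚ.≤-trans u≤v (proj₁ (contains vw))) (ℚ.≤-trans w≤z (proj₂ (contains uz)))

  module _ (4<k : 4 ℕ.< k) (c : Fin k → Vertex G)
           (adj : ∀ i j → Adj G (c i) (c j) ⇔ CycAdj G k i j) where

    private
      next-adj : ∀ {i j} → Next k i j → Adj G (c i) (c j)
      next-adj = Equivalence.from (adj _ _) ∘ Next⇒CycAdj G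

      prev-adj : ∀ {i j} → Next k j i → Adj G (c i) (c j)
      prev-adj = Equivalence.from (adj _ _) ∘ CycAdj-sym G ∘ Next⇒CycAdj G

    -- Follow the cycle two steps from `v` in both directions. Crossing edges then force an edge
    -- between positions three steps apart.
    no-greatest-lo : ∀ i v → c i ≡ inj₁ v →
      (∀ j u → c j ≡ inj₁ u → loX u ℚ.≤ loX v) → ⊥
    no-greatest-lo i v ci≡v greatest
      with a , ia ← next i | b , bi ← prev i
      with a⁺ , aa⁺ ← next a | b⁻ , b⁻b ← prev b
      with z , ca≡z , vz ← Adj-inj₁ G (subst (λ p → Adj G p (c a)) ci≡v (next-adj ia))
         | w , cb≡w , vw ← Adj-inj₁ G (subst (λ p → Adj G p (c b)) ci≡v (prev-adj bi))
      with u , ca⁺≡u , uz ← Adj-inj₂ G (subst (λ p → Adj G p (c a⁺)) ca≡z (next-adj aa⁺))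
         | t , cb⁻≡t , tw ← Adj-inj₂ G (subst (λ p → Adj G p (c b⁻)) cb≡w (prev-adj b⁻b))
      -- The neighbour of `v` with the smaller right endpoint gets joined to the far vertex on the
      -- other side.
      with ℚ.≤-total (hiY w) (hiY z)
    ... | inj₁ w≤z = distance3-nonadjacent G 4<k bi ia aa⁺
      (Equivalence.to (adj b a⁺)
        (subst₂ (Adj G) (sym cb≡w) (sym ca⁺≡u)
          (crossing⇒edge (greatest a⁺ u ca⁺≡u) w≤z uz vw)))
    ... | inj₂ z≤w = distance3-nonadjacent G 4<k b⁻b bi ia
      (Equivalence.to (adj b⁻ a)
        (subst₂ (Adj G) (sym cb⁻≡t) (sym ca≡z)
          (crossing⇒edge (greatest b⁻ t cb⁻≡t) z≤w tw vz)))

    private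
      start : Fin k
      start = fromℕ< (ℕ.<-trans (s≤s z≤n) 4<k)

      ∃-x-vertex : ∃₂ λ i x → c i ≡ inj₁ x
      ∃-x-vertex with c start in eq
      ... | inj₁ x = start , x , eq
      ... | inj₂ y with j , ij ← next start
        with x , cj≡x , _ ← Adj-inj₂ G (subst (λ p → Adj G p (c j)) eq (next-adj ij))
        = j , x , cj≡x

    no-long-cycle : ⊥
    no-long-cycle with i₀ , x₀ , eq₀ ← ∃-x-vertex = no-greatest-lo i v ci≡v λ j u cj≡u →
      subst (λ p → loX (toX p) ℚ.≤ loX v) cj≡u
        (All.lookup (All.map⁻ (f[xs]≤f[argmax] {f = loX} x₀ xs)) (∈-allFin j))
      where
      open Extrema (DecTotalOrder.totalOrder ℚ.≤-decTotalOrder)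

      -- Y-vertices are sent to `x₀`, which lies on the cycle, so the maximum is still attained on
      -- the cycle.
      toX : Vertex G → Fin m
      toX = Sum.[ id , (λ _ → x₀) ]

      xs = map (toX ∘ c) (allFin _)

      v : Fin m
      v = argmax loX x₀ xs

      on-cycle : ∀ j → ∃ λ i → c i ≡ inj₁ (toX (c j))
      on-cycle j with c j in eq
      ... | inj₁ x = j , eq
      ... | inj₂ _ = i₀ , eq₀

      v-on-cycle : ∃ λ i → c i ≡ inj₁ v
      v-on-cycle = argmax-all loX {P = λ x → ∃ λ i → c i ≡ inj₁ x} {xs = xs} (i₀ , eq₀)
                     (All.map⁺ (All.tabulate {xs = allFin _} λ {j} _ → on-cycle j))

      i = proj₁ v-on-cycle
      ci≡v = proj₂ v-on-cycle

  intervalContainment⇒chordal : IsChordalBigraph G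
  intervalContainment⇒chordal k 4<k (c , _ , adj) = no-long-cycle 4<k c adj

-- Cocomparability

module LexByKey (key : Fin n → ℚ) where

  infix 4 _≺_
  -- Endpoints may coincide; the index breaks ties to make the order total.
  _≺_ : Rel (Fin n) _
  i ≺ j = key i ℚ.< key j ⊎ (key i ≡ key j × i Fin.< j)

  ≺⇒≤ : ∀ {i j} → i ≺ j → key i ℚ.≤ key j
  ≺⇒≤ (inj₁ i<j)       = ℚ.<⇒≤ i<j
  ≺⇒≤ (inj₂ (i≡j , _)) = ℚ.≤-reflexive i≡j

  ≺-isStrictTotalOrder : IsStrictTotalOrder _≡_ _≺_
  ≺-isStrictTotalOrder = isStrictTotalOrderᶜ record
    { isEquivalence = isEquivalence ; trans = ≺-trans ; compare = compare }
    where
    ≺-trans : Transitive _≺_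
    ≺-trans (inj₁ p)       (inj₁ q)       = inj₁ (ℚ.<-trans p q)
    ≺-trans {i} (inj₁ p)   (inj₂ (q , _)) = inj₁ (subst (key i ℚ.<_) q p)
    ≺-trans {k = k} (inj₂ (p , _)) (inj₁ q) = inj₁ (subst (ℚ._< key k) (sym p) q)
    ≺-trans (inj₂ (p , r)) (inj₂ (q , s)) = inj₂ (trans p q , Fin.<-trans r s)

    compare : ∀ i j → Tri (i ≺ j) (i ≡ j) (j ≺ i)
    compare i j with ℚ.<-cmp (key i) (key j)
    ... | tri< p q r = tri< (inj₁ p) (q ∘ cong key)
                            Sum.[ r , q ∘ sym ∘ proj₁ ]
    ... | tri> p q r = tri> Sum.[ p , q ∘ proj₁ ] (q ∘ cong key) (inj₁ r)
    ... | tri≈ p q r with Fin.<-cmp i j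
    ...   | tri< s t o = tri< (inj₂ (q , s)) t Sum.[ r , o ∘ proj₂ ]
    ...   | tri≈ s t o = tri≈ Sum.[ p , s ∘ proj₂ ] t Sum.[ r , o ∘ proj₂ ]
    ...   | tri> s t o = tri> Sum.[ p , s ∘ proj₂ ] t (inj₂ (sym q , o))

intervalContainment⇒cocomparability : {G : BiGraph m n} →
  IsIntervalContainmentBigraph G → IsCocomparabilityBigraph G
intervalContainment⇒cocomparability {G = G} (IX , IY , rep) =
  X._≺_ , Y._≺_ , X.≺-isStrictTotalOrder , Y.≺-isStrictTotalOrder , cocomparable
  where
  module X = LexByKey (Interval.lo ∘ IX)
  module Y = LexByKey (Interval.lo ∘ IY)

  cocomparable : ∀ u v w z → u X.≺ v → w Y.≺ z → Edge G u z → Edge G v w →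
                 Edge G u w ⊎ Edge G v z
  cocomparable u v w z u≺v w≺z uz vw
    with lu≤lz , rz≤ru ← Equivalence.to (rep u z) uz
       | lv≤lw , rw≤rv ← Equivalence.to (rep v w) vw
    -- In the second case the right endpoints of `z`, `u`, `w`, `v` increase weakly in this order.
    with ℚ.≤-total (Interval.hi (IY w)) (Interval.hi (IX u))
  ... | inj₁ rw≤ru = inj₁ (Equivalence.from (rep u w) (ℚ.≤-trans (X.≺⇒≤ u≺v) lv≤lw , rw≤ru))
  ... | inj₂ ru≤rw = inj₂ (Equivalence.from (rep v z)
    (ℚ.≤-trans lv≤lw (Y.≺⇒≤ w≺z) , ℚ.≤-trans rz≤ru (ℚ.≤-trans ru≤rw rw≤rv)))

-- Induced 6-cycles

-- K₃,₃ minus a perfect matching, which is the 6-cycle.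
crown : BiGraph 3 3
crown a b = not (does (a Fin.≟ b))

-- Opposite positions carry equal indices: they are the pairs of the removed matching.
crown-cycle : Fin 6 → Fin 3 ⊎ Fin 3
crown-cycle 0F = inj₁ 0F
crown-cycle 1F = inj₂ 1F
crown-cycle 2F = inj₁ 2F
crown-cycle 3F = inj₂ 0F
crown-cycle 4F = inj₁ 1F
crown-cycle 5F = inj₂ 2F

crown-cycle-injective : Injective _≡_ _≡_ crown-cycle
crown-cycle-injective = from-yes (Fin.all? λ i → Fin.all? λ j →
  Sum.≡-dec Fin._≟_ Fin._≟_ (crown-cycle i) (crown-cycle j) →-dec i Fin.≟ j) _ _

crown-cycle-induced : ∀ i j → Adj crown (crown-cycle i) (crown-cycle j) ⇔ CycAdj crown 6 i j
crown-cycle-induced = from-yes (Fin.all? λ i → Fin.all? λ j →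
  Adj? (crown-cycle i) (crown-cycle j) ⇔-dec CycAdj? i j)
  where
  Adj? : Decidable (Adj crown)
  Adj? (inj₁ _) (inj₁ _) = no λ ()
  Adj? (inj₁ x) (inj₂ y) = Edge? crown x y
  Adj? (inj₂ y) (inj₁ x) = Edge? crown x y
  Adj? (inj₂ _) (inj₂ _) = no λ ()

  CycAdj? : Decidable (CycAdj crown 6)
  CycAdj? i j =
    (suc (toℕ i) ℕ.≟ toℕ j) ⊎-dec (suc (toℕ j) ℕ.≟ toℕ i)
    ⊎-dec ((suc (toℕ i) ℕ.≟ 6 ×-dec toℕ j ℕ.≟ 0) ⊎-dec (suc (toℕ j) ℕ.≟ 6 ×-dec toℕ i ℕ.≟ 0))

module _ (G : BiGraph m n) (xs : Fin 3 → Fin m) (ys : Fin 3 → Fin n)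
         (induced : ∀ a b → G (xs a) (ys b) ≡ crown a b) where

  private
    diagonal : ∀ a → crown a a ≡ false
    diagonal a = cong not (dec-true (a Fin.≟ a) refl)

    crown-separates : ∀ {a b} → crown a b ≡ false → a ≡ b
    crown-separates {a} {b} eq with a Fin.≟ b
    ... | yes a≡b = a≡b

    -- Each row of `crown` is false only on the diagonal, so it determines its index.
    xs-injective : Injective _≡_ _≡_ xs
    xs-injective {a} {b} eq = crown-separates
      (trans (sym (induced a b)) (trans (cong (λ x → G x (ys b)) eq) (trans (induced b b) (diagonal b))))

    ys-injective : Injective _≡_ _≡_ ys
    ys-injective {a} {b} eq = crown-separates
      (trans (sym (induced a b)) (trans (cong (G (xs a)) (sym eq)) (trans (induced a a) (diagonal a))))

    embed : Vertex crown → Vertex G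
    embed = Sum.map xs ys

    embed-injective : Injective _≡_ _≡_ embed
    embed-injective {inj₁ _} {inj₁ _} eq = cong inj₁ (xs-injective (Sum.inj₁-injective eq))
    embed-injective {inj₂ _} {inj₂ _} eq = cong inj₂ (ys-injective (Sum.inj₂-injective eq))

    embed-adj : ∀ p q → Adj G (embed p) (embed q) ≡ Adj crown p q
    embed-adj (inj₁ _) (inj₁ _) = refl
    embed-adj (inj₁ a) (inj₂ b) = cong (_≡ true) (induced a b)
    embed-adj (inj₂ b) (inj₁ a) = cong (_≡ true) (induced a b)
    embed-adj (inj₂ _) (inj₂ _) = refl

  induced-crown⇒C₆ : HasInducedCycle G 6
  induced-crown⇒C₆ = embed ∘ crown-cycle , crown-cycle-injective ∘ embed-injective ,
    λ i j → subst (_⇔ CycAdj G 6 i j) (sym (embed-adj (crown-cycle i) (crown-cycle j)))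
                  (crown-cycle-induced i j)

-- Coordinates from a cocomparability ordering

module _ {_<_ : Rel (Fin n) ℓ} (_<?_ : Decidable _<_) where

  private
    below : Fin n → Subset n
    below i = tabulate λ j → does (j <? i)

    below⁺ : ∀ {i j} → j < i → j ∈ below i
    below⁺ {i} {j} j<i =
      lookup⇒[]= j (below i) (trans (lookup∘tabulate _ j) (dec-true (j <? i) j<i))

    below⁻ : ∀ {i j} → j ∈ below i → j < i
    below⁻ {i} {j} j∈ with j <? i | trans (sym (lookup∘tabulate (λ j → does (j <? i)) j)) ([]=⇒lookup j∈)
    ... | yes j<i | _ = j<i

  rank : Fin n → ℕ
  rank i = ∣ below i ∣

  rank≤n : ∀ i → rank i ℕ.≤ n
  rank≤n i = ∣p∣≤n (below i)

  -- The set below `i` is contained in the set below `j`, properly because it misses `i`.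
  rank-mono-< : Irreflexive _≡_ _<_ → Transitive _<_ → ∀ {i j} → i < j → rank i ℕ.< rank j
  rank-mono-< irrefl <-trans {i} i<j = p⊂q⇒∣p∣<∣q∣
    ((λ h∈ → below⁺ (<-trans (below⁻ h∈) i<j)) , i , below⁺ i<j , irrefl refl ∘ below⁻)

module Coordinates
  (G : BiGraph m n) {_<X_ : Rel (Fin m) 0ℓ} {_<Y_ : Rel (Fin n) 0ℓ}
  (isX : IsStrictTotalOrder _≡_ _<X_) (isY : IsStrictTotalOrder _≡_ _<Y_)
  (cocomparable : ∀ u v w z → u <X v → w <Y z → Edge G u z → Edge G v w →
                  Edge G u w ⊎ Edge G v z)
  where

  private
    module X = IsStrictTotalOrder isX
    module Y = IsStrictTotalOrder isY

  -- Picture the biadjacency matrix with X ordered downwards and Y to the right: position `u w` is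
  -- to the lower left of the non-edge `v z`.
  LowerLeft : Fin m → Fin n → Set
  LowerLeft u w = ∃₂ λ v z → v <X u × w <Y z × Edge G u z × Edge G v w × ¬ Edge G v z

  LowerLeft? : Decidable LowerLeft
  LowerLeft? u w = Fin.any? λ v → Fin.any? λ z →
    v X.<? u ×-dec w Y.<? z ×-dec Edge? G u z ×-dec Edge? G v w ×-dec ¬? (Edge? G v z)

  Free : Fin m → Fin n → Set
  Free u w = ¬ Edge G u w × ¬ LowerLeft u w

  Free? : Decidable Free
  Free? u w = ¬? (Edge? G u w) ×-dec ¬? (LowerLeft? u w)

  -- Cocomparability excludes that `u`, `v` and `w`, `z` are ordered alike; of the two opposite
  -- orders, freeness excludes the one making `u w` lower left.
  free-conflict : ∀ {u v w z} → Free u w → Edge G u z → Edge G v w → ¬ Edge G v z →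
    u <X v × z <Y w
  free-conflict {u} {v} {w} {z} (¬uw , ¬ll) uz vw ¬vz with X.compare u v | Y.compare w z
  ... | tri≈ _ refl _ | _             = contradiction vw ¬uw
  ... | _             | tri≈ _ refl _ = contradiction uz ¬uw
  ... | tri< u<v _ _  | tri> _ _ z<w  = u<v , z<w
  ... | tri< u<v _ _  | tri< w<z _ _  =
    ⊥-elim (Sum.[ ¬uw , ¬vz ] (cocomparable u v w z u<v w<z uz vw))
  ... | tri> _ _ v<u  | tri> _ _ z<w  =
    ⊥-elim (Sum.[ ¬vz , ¬uw ] (cocomparable v u z w v<u z<w vw uz))
  ... | tri> _ _ v<u  | tri< w<z _ _  = contradiction (v , z , v<u , w<z , uz , vw , ¬vz) ¬ll

  -- x′ ≺ x forces the left endpoint of x′ below that of x.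
  infix 4 _≺_
  _≺_ : Rel (Fin m) _
  x′ ≺ x = ∃ λ y → Edge G x′ y × Free x y

  _≺?_ : Decidable _≺_
  x′ ≺? x = Fin.any? λ y → Edge? G x′ y ×-dec Free? x y

  ≺-irrefl : Irreflexive _≡_ _≺_
  ≺-irrefl refl (_ , xy , ¬xy , _) = ¬xy xy

  -- If `x″ y` is not an edge, the witness is `y′`, and freeness has to be carried over from `x y`
  -- and `x′ y′` to `x y′`.
  ≺-trans : Transitive _≺_
  ≺-trans {x″} {x′} {x} (y′ , x″y′ , fx′y′@(¬x′y′ , _)) (y , x′y , fxy) with Edge? G x″ y
  ... | yes x″y = y , x″y , fxy
  ... | no ¬x″y = y′ , x″y′ , ¬xy′ , ¬ll
    where
    -- Otherwise the free non-edges `x y` and `x′ y′` conflict, and each would be upper right of the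
    -- other.
    ¬xy′ : ¬ Edge G x y′
    ¬xy′ xy′ = X.asym (proj₁ (free-conflict fxy xy′ x′y ¬x′y′))
                      (proj₁ (free-conflict fx′y′ x′y xy′ (proj₁ fxy)))

    y<y′ : y <Y y′
    y<y′ = proj₂ (free-conflict fx′y′ x′y x″y′ ¬x″y)

    -- Freeness of `x′ y′` would put `z` before `y′` if `x′ z` is an edge; otherwise freeness of
    -- `x y` would put `z` before `y`.
    ¬ll : ¬ LowerLeft x y′
    ¬ll (v , z , v<x , y′<z , xz , vy′ , ¬vz) with Edge? G x′ z
    ... | yes x′z = Y.asym y′<z (proj₂ (free-conflict fx′y′ x′z vy′ ¬vz))
    ... | no ¬x′z = Y.asym (Y.trans y<y′ y′<z) (proj₂ (free-conflict fxy xz x′y ¬x′z))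

  -- The `suc` keeps every X-coordinate above 0, the Y-coordinate of an isolated `y`.
  coordX : Fin m → ℕ
  coordX x = suc (rank _≺?_ x)

  private
    neighbourCoords : Fin n → _
    neighbourCoords y = map coordX (filter (λ x → Edge? G x y) (allFin m))

  -- The least value that the edges at `y` permit.
  coordY : Fin n → ℕ
  coordY y = max 0 (neighbourCoords y)

  private
    coordY< : ∀ {y b} → 0 ℕ.< b → (∀ {x} → Edge G x y → coordX x ℕ.< b) → coordY y ℕ.< b
    coordY< {y} 0<b bound = max<v⁺ {xs = neighbourCoords y} 0<b
      (All.map⁺ (All.tabulate (bound ∘ proj₂ ∘ ∈-filter⁻ (λ x → Edge? G x y) {xs = allFin m})))

  coordX≤ : ∀ x → coordX x ℕ.≤ suc m
  coordX≤ x = s≤s (rank≤n _≺?_ x)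

  coordY≤ : ∀ y → coordY y ℕ.≤ suc m
  coordY≤ y = ℕ.s≤s⁻¹ (coordY< (s≤s z≤n) λ {x} _ → s≤s (coordX≤ x))

  edge⇒≤ : ∀ {x y} → Edge G x y → coordX x ℕ.≤ coordY y
  edge⇒≤ {x} {y} xy = All.lookup (xs≤max 0 (neighbourCoords y))
    (∈-map⁺ coordX (∈-filter⁺ (λ x → Edge? G x y) (∈-allFin x) xy))

  -- Every neighbour `x′` of `y` satisfies `x′ ≺ x`, with `y` itself as witness, so the maximum over
  -- the neighbours stays below `x`.
  free⇒> : ∀ {x y} → Free x y → coordY y ℕ.< coordX x
  free⇒> {y = y} fxy = coordY< (s≤s z≤n) λ x′y →
    s≤s (rank-mono-< _≺?_ ≺-irrefl ≺-trans (y , x′y , fxy))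

-- Interval representation from the coordinates

fromℕ : ℕ → ℚ
fromℕ k = mkℚ (+ k) 0 (coprime-sym (1-coprimeTo k))

fromℕ-mono-≤ : ∀ {j k} → j ℕ.≤ k → fromℕ j ℚ.≤ fromℕ k
fromℕ-mono-≤ j≤k = *≤* (ℤ.*-monoʳ-≤-nonNeg (+ 1) (ℤ.+≤+ j≤k))

fromℕ-cancel-≤ : ∀ {j k} → fromℕ j ℚ.≤ fromℕ k → j ℕ.≤ k
fromℕ-cancel-≤ {j} {k} (*≤* p) = ℤ.drop‿+≤+ (ℤ.*-cancelʳ-≤-pos (+ j) (+ k) (+ 1) p)

C₆-free∧cocomparability⇒intervalContainment : (G : BiGraph m n) →
  ¬ HasInducedCycle G 6 → IsCocomparabilityBigraph G → IsIntervalContainmentBigraph G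
C₆-free∧cocomparability⇒intervalContainment {m} {n} G ¬C₆ (_<X_ , _<Y_ , isX , isY , cocomparable) =
  (λ x → interval (L.coordX x) (R.coordX x) (L.coordX≤ x) (R.coordX≤ x)) ,
  (λ y → interval (L.coordY y) (R.coordY y) (L.coordY≤ y) (R.coordY≤ y)) ,
  (λ x y → mk⇔ edge⇒⊇ ⊇⇒edge)
  where
  module L = Coordinates G isX isY cocomparable
  -- Reversing both orders turns lower left into upper right and preserves cocomparability.
  module R = Coordinates G (Flip.isStrictTotalOrder isX) (Flip.isStrictTotalOrder isY)
    (λ u v w z v<u z<w uz vw → Sum.swap (cocomparable v u z w v<u z<w vw uz))

  -- This bounds all coordinates; right endpoints are measured down from 2N, hence are at least N
  -- and so not below any left endpoint.
  N = suc m

  -- Since r ≤ N ≤ 2N, the subtraction is strictly antitone in r.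
  interval : ∀ l r → l ℕ.≤ N → r ℕ.≤ N → Interval G
  interval l r l≤N r≤N = record
    { lo = fromℕ l
    ; hi = fromℕ (N + N ∸ r)
    ; lo≤hi = fromℕ-mono-≤ (ℕ.≤-trans l≤N (ℕ.m+n≤o⇒m≤o∸n N (ℕ.+-monoʳ-≤ N r≤N)))
    }

  -- Rows `v′`, `u`, `v` and columns `z′`, `w`, `z` form a `crown` whose diagonal consists of the
  -- three non-edges. The two edges not given, `v′ z` and `v z′`, follow from cocomparability, since
  -- `u w` is a non-edge.
  not-both : ∀ {u w} → ¬ Edge G u w → L.LowerLeft u w → ¬ R.LowerLeft u w
  not-both {u} {w} ¬uw (v′ , z′ , v′<u , w<z′ , uz′ , v′w , ¬v′z′)
                       (v , z , u<v , z<w , uz , vw , ¬vz) =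
    ¬C₆ (induced-crown⇒C₆ G xs ys induced)
    where
    xs : Fin 3 → Fin m
    xs 0F = v′
    xs 1F = u
    xs 2F = v

    ys : Fin 3 → Fin n
    ys 0F = z′
    ys 1F = w
    ys 2F = z

    v′z : Edge G v′ z
    v′z = Sum.[ id , (λ e → contradiction e ¬uw) ] (cocomparable v′ u z w v′<u z<w v′w uz)

    vz′ : Edge G v z′
    vz′ = Sum.[ (λ e → contradiction e ¬uw) , id ] (cocomparable u v w z′ u<v w<z′ uz′ vw)

    induced : ∀ a b → G (xs a) (ys b) ≡ crown a b
    induced 0F 0F = Bool.¬-not ¬v′z′
    induced 0F 1F = v′w
    induced 0F 2F = v′z
    induced 1F 0F = uz′
    induced 1F 1F = Bool.¬-not ¬uw
    induced 1F 2F = uz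
    induced 2F 0F = vz′
    induced 2F 1F = vw
    induced 2F 2F = Bool.¬-not ¬vz

  edge⇒⊇ : ∀ {x y} → Edge G x y →
    fromℕ (L.coordX x) ℚ.≤ fromℕ (L.coordY y) ×
    fromℕ (N + N ∸ R.coordY y) ℚ.≤ fromℕ (N + N ∸ R.coordX x)
  edge⇒⊇ xy = fromℕ-mono-≤ (L.edge⇒≤ xy) , fromℕ-mono-≤ (ℕ.∸-monoʳ-≤ (N + N) (R.edge⇒≤ xy))

  ⊇⇒edge : ∀ {x y} →
    fromℕ (L.coordX x) ℚ.≤ fromℕ (L.coordY y) ×
    fromℕ (N + N ∸ R.coordY y) ℚ.≤ fromℕ (N + N ∸ R.coordX x) → Edge G x y
  ⊇⇒edge {x} {y} (l , r) with Edge? G x y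
  ... | yes xy = xy
  -- A non-edge that is not lower left fails at the left endpoints; a lower left one is not upper
  -- right, so it fails at the right endpoints.
  ... | no ¬xy with L.LowerLeft? x y
  ...   | no ¬ll = contradiction (fromℕ-cancel-≤ l) (ℕ.<⇒≱ (L.free⇒> (¬xy , ¬ll)))
  ...   | yes ll = contradiction (fromℕ-cancel-≤ r)
    (ℕ.<⇒≱ (ℕ.∸-monoʳ-< (R.free⇒> (¬xy , not-both ¬xy ll))
             (ℕ.≤-trans (R.coordX≤ x) (ℕ.m≤m+n N N))))

theorem4p5 : ∀ (m n : ℕ) (G : BiGraph m n) →
    (IsIntervalContainmentBigraph G ⇔ (IsChordalBigraph G × IsCocomparabilityBigraph G))
    × ((IsChordalBigraph G × IsCocomparabilityBigraph G)
    ⇔ (¬ HasInducedCycle G 6 × IsCocomparabilityBigraph G))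
theorem4p5 m n G =
  mk⇔ i⇒ii (iii⇒i ∘ ii⇒iii) , mk⇔ ii⇒iii (i⇒ii ∘ iii⇒i)
  where
  i⇒ii : IsIntervalContainmentBigraph G → IsChordalBigraph G × IsCocomparabilityBigraph G
  i⇒ii rep = intervalContainment⇒chordal rep , intervalContainment⇒cocomparability rep

  ii⇒iii : IsChordalBigraph G × IsCocomparabilityBigraph G →
           ¬ HasInducedCycle G 6 × IsCocomparabilityBigraph G
  ii⇒iii (chordal , cocomp) = chordal 6 (s≤s (s≤s (s≤s (s≤s (s≤s z≤n))))) , cocomp

  iii⇒i : ¬ HasInducedCycle G 6 × IsCocomparabilityBigraph G → IsIntervalContainmentBigraph G
  iii⇒i (¬C₆ , cocomp) = C₆-free∧cocomparability⇒intervalContainment G ¬C₆ cocomp
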